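{- Let $p$ be a prime, let $d, w_1, w_2 \in \mathbb{N}$, let $\chi$ be a Dirichlet character with conductor $d$ (with values in $\mathbb{C}_p$), and let $\xi \in T_p$. For all $n \in \mathbb{Z}_+$ and $m \in \mathbb{N}$, $$\sum_{j=0}^{n}\binom{n}{j}w_2^{j} w_1^{n-j-1}B_{n-j,\chi,\xi^{w_1}}^{(m)}\sum_{k=0}^{j}\binom{j}{k}T_{k,\chi,\xi^{w_2}}(w_1d-1)\,B_{j-k,\chi,\xi^{w_2}}^{(m-1)}$$ $$=\sum_{j=0}^{n}\binom{n}{j}w_1^{j} w_2^{n-j-1}B_{n-j,\chi,\xi^{w_2}}^{(m)}\sum_{k=0}^{j}\binom{j}{k}T_{k,\chi,\xi^{w_1}}(w_2d-1)\,B_{j-k,\chi,\xi^{w_1}}^{(m-1)}.$$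
   Context: $\mathbb{N}=\{1,2,3,\dots\}$ and $\mathbb{Z}_+=\mathbb{N}\cup\{0\}$. $\mathbb{C}_p$ is the completion of an algebraic closure of $\mathbb{Q}_p$. $T_p=\bigcup_{n\ge 1}\{\omega\in\mathbb{C}_p : \omega^{p^n}=1\}$ is the group of $p$-power roots of unity. For $\xi\in T_p$, a Dirichlet character $\chi$ with conductor $d$, and an integer $k\ge 0$, the generalized twisted Bernoulli polynomials of order $k$ attached to $\chi$, $B_{n,\chi,\xi}^{(k)}(x)$, are defined by the identity of formal power series in $t$ $$\left(\frac{t\sum_{a=0}^{d-1}\chi(a)\xi^a e^{at}}{\xi^d e^{dt}-1}\right)^k e^{xt}=\sum_{n=0}^{\infty}B_{n,\chi,\xi}^{(k)}(x)\frac{t^n}{n!}$$ (so for $k=0$ one has $B_{n,\chi,\xi}^{(0)}(x)=x^n$, with $0^0=1$). The generalized twisted Bernoulli numbers of order $k$ attached to $\chi$ are $B_{n,\chi,\xi}^{(k)}=B_{n,\chi,\xi}^{(k)}(0)$. For $k,n\in\mathbb{Z}_+$, the power sums are $T_{k,\chi,\xi}(n)=\sum_{l=0}^{n}\chi(l)\xi^l l^k$, with $0^0=1$. -}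

module Defs where

open import Algebra.Bundles using (CommutativeRing)
open import Algebra.Apartness.Bundles using (HeytingField)
import Algebra.Apartness.Properties.HeytingCommutativeRing as HeytingProperties
import Algebra.Properties.Semiring.Exp as Exp
import Algebra.Properties.Semiring.Mult as Mult
import Algebra.Properties.Semiring.Sum as Sum
open import Data.Fin.Base using (Fin; toℕ)
open import Data.Integer.Base as ℤ using (ℤ; +_; -[1+_]; 1ℤ)
open import Data.Integer.Coprimality using (Coprime)
open import Data.Nat.Base as ℕ using (ℕ; zero; suc; NonZero; _∸_; _!)
open import Data.Nat.Divisibility using (_∣_)
open import Data.Nat.Properties using (_!≢0)
open import Data.Product.Base using (Σ-syntax; ∃-syntax; _×_; _,_; proj₁; proj₂)
open import Data.Rational.Base as ℚ using (ℚ; 1ℚ)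
open import Function.Base using (_∘_)
open import Level using (Level; _⊔_) renaming (suc to lsuc)
open import Relation.Binary.Construct.Add.Supremum.NonStrict ℚ._≤_ using (_≤⁺_)
open import Relation.Binary.PropositionalEquality.Core as ≡ using (_≡_; _≢_)
import Relation.Binary.Reasoning.Setoid as SetoidReasoning
open import Relation.Nullary.Construct.Add.Supremum using (_⁺; [_]; ⊤⁺)
open import Relation.Nullary.Decidable.Core using (Dec; yes; no)
open import Relation.Nullary.Negation.Core using (¬_)

infixl 6 _+⁺_

_+⁺_ : ℚ ⁺ → ℚ ⁺ → ℚ ⁺
[ a ] +⁺ [ b ] = [ a ℚ.+ b ]
[ _ ] +⁺ ⊤⁺    = ⊤⁺
⊤⁺    +⁺ _     = ⊤⁺

-- The completion of an algebraic closure of ℚₚ, characterised up to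
-- isomorphism.  In place of the absolute value, whose nonzero values are the
-- rational powers of p, we use the valuation v = - logₚ |_| : ℂₚ → ℚ ∪ {∞},
-- where ∞ is ⊤⁺.

record ComplexPadicField (p : ℕ) (c ℓ₁ ℓ₂ : Level) : Set (lsuc (c ⊔ ℓ₁ ⊔ ℓ₂)) where
  field
    heytingField : HeytingField c ℓ₁ ℓ₂

  open HeytingField heytingField public

  commutativeRing : CommutativeRing c ℓ₁
  commutativeRing = record { isCommutativeRing = isCommutativeRing }

  open CommutativeRing commutativeRing public using (semiring)

  open Exp semiring public using (_^_)
  open Mult semiring public using () renaming (_×_ to _•_)
  open Sum semiring public using (sum)

  ι : ℕ → Carrier
  ι n = n • 1#

  field
    -- Implied by v-p: in positive characteristic v (ι p) would be 0 or ∞.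
    ι#0         : ∀ n .{{_ : NonZero n}} → ι n # 0#
    v           : Carrier → ℚ ⁺
    v-cong      : ∀ {x y} → x ≈ y → v x ≡ v y
    #0⇒v-finite : ∀ {x} → x # 0# → v x ≢ ⊤⁺
    v-finite⇒#0 : ∀ {x} → v x ≢ ⊤⁺ → x # 0#
    v-*         : ∀ x y → v (x * y) ≡ v x +⁺ v y
    v-+         : ∀ {r x y} → r ≤⁺ v x → r ≤⁺ v y → r ≤⁺ v (x + y)
    v-p         : v (ι p) ≡ [ 1ℚ ]

  Close : ℚ → Carrier → Carrier → Set
  Close r x y = [ r ] ≤⁺ v (x - y)

  Cauchy : (ℕ → Carrier) → Set
  Cauchy s = ∀ r → ∃[ N ] (∀ m n → N ℕ.≤ m → N ℕ.≤ n → Close r (s m) (s n))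

  _⟶_ : (ℕ → Carrier) → Carrier → Set
  s ⟶ x = ∀ r → ∃[ N ] (∀ n → N ℕ.≤ n → Close r (s n) x)

  _∈ℚ : Carrier → Set ℓ₁
  x ∈ℚ = ∃[ a ] ∃[ b ] ∃[ n ] ι (suc n) * x ≈ ι a - ι b

  -- Given `complete` below, the closure of ℚ is its p-adic completion.
  _∈ℚₚ : Carrier → Set (c ⊔ ℓ₁)
  x ∈ℚₚ = ∀ r → ∃[ q ] q ∈ℚ × Close r x q

  -- xⁿ + aₙ₋₁ xⁿ⁻¹ + ⋯ + a₀
  monic : ∀ {n} → (Fin n → Carrier) → Carrier → Carrier
  monic {n} a x = x ^ n + sum (λ i → a i * x ^ toℕ i)

  _∈ℚ̄ₚ : Carrier → Set (c ⊔ ℓ₁)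
  x ∈ℚ̄ₚ = ∃[ n ] Σ[ a ∈ (Fin n → Carrier) ] (∀ i → a i ∈ℚₚ) × monic a x ≈ 0#

  field
    complete      : ∀ s → Cauchy s → ∃[ x ] s ⟶ x
    ℚ̄ₚ-algClosed : ∀ n (a : Fin (suc n) → Carrier) → (∀ i → a i ∈ℚ̄ₚ) →
                    ∃[ x ] x ∈ℚ̄ₚ × monic a x ≈ 0#
    ℚ̄ₚ-dense      : ∀ x r → ∃[ y ] y ∈ℚ̄ₚ × Close r x y

  #0? : ∀ x → Dec (x # 0#)
  #0? x with v x in eq
  ... | [ _ ] = yes (v-finite⇒#0 λ v≡⊤ → [q]≢⊤ (≡.trans (≡.sym eq) v≡⊤))
    where
    [q]≢⊤ : ∀ {q : ℚ} → [ q ] ≢ ⊤⁺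
    [q]≢⊤ ()
  ... | ⊤⁺    = no λ x#0 → #0⇒v-finite x#0 eq

  infix 9 _⁻¹
  infixr 8 _^ℤ_

  -- 0⁻¹ = 0 by convention.
  _⁻¹ : Carrier → Carrier
  x ⁻¹ with #0? x
  ... | yes x#0 = proj₁ (#⇒invertible x#0)
  ... | no  _   = 0#

  _^ℤ_ : Carrier → ℤ → Carrier
  x ^ℤ (+ n)    = x ^ n
  x ^ℤ -[1+ n ] = (x ⁻¹) ^ suc n

  ∑≤ : ℕ → (ℕ → Carrier) → Carrier
  ∑≤ n f = sum {suc n} (f ∘ toℕ)

  ∑< : ℕ → (ℕ → Carrier) → Carrier
  ∑< n f = sum {n} (f ∘ toℕ)

  infix 5 ∑≤ ∑<

  syntax ∑≤ n (λ i → x) = ∑[ i ≤ n ] x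
  syntax ∑< n (λ i → x) = ∑[ i < n ] x

  _∈T : Carrier → Set ℓ₁
  ξ ∈T = ∃[ n ] 1 ℕ.≤ n × ξ ^ (p ℕ.^ n) ≈ 1#

module TwistedBernoulli {p c ℓ₁ ℓ₂} (ℂₚ : ComplexPadicField p c ℓ₁ ℓ₂) where

  open ComplexPadicField ℂₚ

  record DirichletCharacter (d : ℕ) : Set (c ⊔ ℓ₁ ⊔ ℓ₂) where
    field
      χ           : ℤ → Carrier
      periodic    : ∀ a → χ (a ℤ.+ + d) ≈ χ a
      χ-*         : ∀ a b → χ (a ℤ.* b) ≈ χ a * χ b
      χ-1         : χ 1ℤ ≈ 1#
      coprime⇒#0  : ∀ a → Coprime a (+ d) → χ a # 0#
      ¬coprime⇒≈0 : ∀ a → ¬ Coprime a (+ d) → χ a ≈ 0#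

  open DirichletCharacter

  InducedFrom : ∀ {d} → DirichletCharacter d → ℕ → Set (c ⊔ ℓ₁ ⊔ ℓ₂)
  InducedFrom {d} ψ f =
    Σ[ φ ∈ DirichletCharacter f ] (∀ a → Coprime a (+ d) → χ ψ a ≈ χ φ a)

  HasConductor : ∀ {d} → DirichletCharacter d → ℕ → Set (c ⊔ ℓ₁ ⊔ ℓ₂)
  HasConductor {d} ψ f =
    f ∣ d × InducedFrom ψ f × (∀ g → g ∣ d → InducedFrom ψ g → f ℕ.≤ g)

  -- f represents ∑ₙ f n tⁿ.
  PowerSeries : Set c
  PowerSeries = ℕ → Carrier

  infix  4 _≋_
  infixl 7 _⊛_ _÷_ _÷ᵤ_
  infixr 8 _^ₛ_

  _≋_ : PowerSeries → PowerSeries → Set ℓ₁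
  f ≋ g = ∀ n → f n ≈ g n

  1ₛ : PowerSeries
  1ₛ zero    = 1#
  1ₛ (suc _) = 0#

  t· : PowerSeries → PowerSeries
  t· f zero    = 0#
  t· f (suc n) = f n

  tail : PowerSeries → PowerSeries
  tail f n = f (suc n)

  _⊛_ : PowerSeries → PowerSeries → PowerSeries
  (f ⊛ g) n = ∑[ i ≤ n ] f i * g (n ∸ i)

  _^ₛ_ : PowerSeries → ℕ → PowerSeries
  f ^ₛ zero  = 1ₛ
  f ^ₛ suc k = f ⊛ (f ^ₛ k)

  exp : Carrier → PowerSeries
  exp x n = x ^ n * (ι (n !)) ⁻¹

  -- Long division by a series with invertible constant term:
  -- if q₀ = f₀ / g₀ then f / g = q₀ + t · ((f - q₀ g) / t) / g.
  _÷ᵤ_ : PowerSeries → PowerSeries → PowerSeries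
  (f ÷ᵤ g) zero    = f 0 * g 0 ⁻¹
  (f ÷ᵤ g) (suc n) = ((λ i → f (suc i) - (f 0 * g 0 ⁻¹) * g (suc i)) ÷ᵤ g) n

  -- The quotient f / g when either g has order 0, or g has order 1 and t
  -- divides f (then t is cancelled first).  No other case arises below.
  _÷_ : PowerSeries → PowerSeries → PowerSeries
  f ÷ g with #0? (g 0)
  ... | yes _ = f ÷ᵤ g
  ... | no  _ = tail f ÷ᵤ tail g

  module _ {d : ℕ} (ψ : DirichletCharacter d) (ξ : Carrier) where

    numerator : PowerSeries
    numerator = t· λ n → ∑[ a < d ] χ ψ (+ a) * ξ ^ a * exp (ι a) n

    denominator : PowerSeries
    denominator n = ξ ^ d * exp (ι d) n - 1ₛ n

    bernoulliPoly : (k n : ℕ) → Carrier → Carrier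
    bernoulliPoly k n x = ι (n !) * (((numerator ÷ denominator) ^ₛ k) ⊛ exp x) n

    bernoulli : (k n : ℕ) → Carrier
    bernoulli k n = bernoulliPoly k n 0#

    powerSum : (k n : ℕ) → Carrier
    powerSum k n = ∑[ l ≤ n ] χ ψ (+ l) * ξ ^ l * ι l ^ k

  open SetoidReasoning setoid
  open HeytingProperties (HeytingField.heytingCommutativeRing heytingField)
    using (x-0≈x; x#0y#0→xy#0; invertibleˡ⇒#; #-congʳ)

  ⁻¹-inverseˡ : ∀ {x} → x # 0# → x ⁻¹ * x ≈ 1#
  ⁻¹-inverseˡ {x} x#0 with #0? x
  ... | yes x#0′ = trans (*-congˡ (sym (x-0≈x x))) (proj₁ (proj₂ (#⇒invertible x#0′)))
  ... | no ¬x#0  with () ← ¬x#0 x#0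

  ⁻¹#0 : ∀ {x} → x # 0# → x ⁻¹ # 0#
  ⁻¹#0 {x} x#0 = invertibleˡ⇒# (x , (begin
    x * (x ⁻¹ - 0#) ≈⟨ *-congˡ (x-0≈x (x ⁻¹)) ⟩
    x * x ⁻¹        ≈⟨ *-comm x (x ⁻¹) ⟩
    x ⁻¹ * x        ≈⟨ ⁻¹-inverseˡ x#0 ⟩
    1#              ∎))

  ^#0 : ∀ {x} → x # 0# → ∀ n → x ^ n # 0#
  ^#0 x#0 zero    = #-congʳ (+-identityʳ 1#) (ι#0 1)
  ^#0 x#0 (suc n) = x#0y#0→xy#0 x#0 (^#0 x#0 n)

  q₀*g₀≈f₀ : ∀ {x} y → x # 0# → (y * x ⁻¹) * x ≈ y
  q₀*g₀≈f₀ {x} y x#0 = begin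
    y * x ⁻¹ * x   ≈⟨ *-assoc y (x ⁻¹) x ⟩
    y * (x ⁻¹ * x) ≈⟨ *-congˡ (⁻¹-inverseˡ x#0) ⟩
    y * 1#         ≈⟨ *-identityʳ y ⟩
    y              ∎

  ÷ᵤ-correct : ∀ f g → g 0 # 0# → (f ÷ᵤ g) ⊛ g ≋ f
  ÷ᵤ-correct f g g₀#0 zero    = trans (+-identityʳ _) (q₀*g₀≈f₀ (f 0) g₀#0)
  ÷ᵤ-correct f g g₀#0 (suc n) = begin
    b + ((r ÷ᵤ g) ⊛ g) n  ≈⟨ +-congˡ (÷ᵤ-correct r g g₀#0 n) ⟩
    b + (f (suc n) - b)   ≈⟨ +-comm b _ ⟩
    f (suc n) - b + b     ≈⟨ +-assoc _ _ _ ⟩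
    f (suc n) + (- b + b) ≈⟨ +-congˡ (-‿inverseˡ b) ⟩
    f (suc n) + 0#        ≈⟨ +-identityʳ _ ⟩
    f (suc n)             ∎
    where
    b = (f 0 * g 0 ⁻¹) * g (suc n)
    r : PowerSeries
    r i = f (suc i) - (f 0 * g 0 ⁻¹) * g (suc i)

  ⊛-tailʳ : ∀ q g → g 0 ≈ 0# → ∀ n → (q ⊛ g) (suc n) ≈ (q ⊛ tail g) n
  ⊛-tailʳ q g g₀≈0 zero    = +-congˡ (trans (+-identityʳ _)
                               (trans (*-congˡ g₀≈0) (zeroʳ _)))
  ⊛-tailʳ q g g₀≈0 (suc n) = +-congˡ (⊛-tailʳ (tail q) g g₀≈0 n)

  ÷-correct : ∀ f g → f 0 ≈ 0# → g 1 # 0# → (f ÷ g) ⊛ g ≋ f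
  ÷-correct f g f₀≈0 g₁#0 n with #0? (g 0)
  ... | yes g₀#0 = ÷ᵤ-correct f g g₀#0 n
  ... | no ¬g₀#0 = go n
    where
    g₀≈0 = proj₁ (tight (g 0) 0#) ¬g₀#0
    go : (tail f ÷ᵤ tail g) ⊛ g ≋ f
    go zero    = begin
      (tail f ÷ᵤ tail g) 0 * g 0 + 0# ≈⟨ +-identityʳ _ ⟩
      (tail f ÷ᵤ tail g) 0 * g 0      ≈⟨ *-congˡ g₀≈0 ⟩
      (tail f ÷ᵤ tail g) 0 * 0#       ≈⟨ zeroʳ _ ⟩
      0#                              ≈⟨ f₀≈0 ⟨
      f 0                             ∎
    go (suc m) = trans (⊛-tailʳ (tail f ÷ᵤ tail g) g g₀≈0 m) (÷ᵤ-correct (tail f) (tail g) g₁#0 m)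

  -- numerator ÷ denominator is a genuine quotient of formal power series.
  generating-identity : ∀ {d} .{{_ : NonZero d}} (ψ : DirichletCharacter d) {ξ} → ξ # 0# →
    (numerator ψ ξ ÷ denominator ψ ξ) ⊛ denominator ψ ξ ≋ numerator ψ ξ
  generating-identity {d} ψ {ξ} ξ#0 = ÷-correct _ _ refl
    (#-congʳ (sym (x-0≈x _))
      (x#0y#0→xy#0 (^#0 ξ#0 d) (x#0y#0→xy#0 (^#0 (ι#0 d) 1) (⁻¹#0 (ι#0 1)))))

{-# OPTIONS --safe #-}
module Submission where

-- Write F_η for the generating series of the twisted Bernoulli numbers,
-- E_η(l) = η^l e^(lt), D_η(N) = E_η(N) - 1 and P_η(N) = Σ_{l<N} χ(l) E_η(l),
-- so that k! times the coefficient of t^k in P_η(N) is the power sum up to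
-- N - 1, and F_η D_η(d) = t P_η(d) by definition (generating-identity).
--
-- A binomial convolution of n! aₙ with n! bₙ is n! times the Cauchy product
-- of a and b (egf-⊛).  Hence, with σ_w f(t) = f(wt), the left-hand side is
-- n! times the coefficient of t^n in
--
--   w₁⁻¹ σ_{w₁}(F_{ξ^w₁})^m · σ_{w₂}(P_{ξ^w₂}(w₁d) F_{ξ^w₂}^(m-1))
--
-- (egf-side), and the right-hand side is the same with w₁ and w₂ exchanged.
-- The factor σ_{w₁}(F_{ξ^w₁})^(m-1) σ_{w₂}(F_{ξ^w₂})^(m-1) is symmetric, so it
-- remains to see that w₂ σ_{w₁}(F_{ξ^w₁}) σ_{w₂}(P_{ξ^w₂}(w₁d)) is symmetric
-- (σF-σP-symmetric).  As χ has period d, a geometric sum gives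
--
--   P_η(wd) D_η(d) = P_η(d) D_η(wd)                        (geometric-sum),
--
-- and σ_w D_{ξ^w}(N) = D_ξ(wN).  So multiplication by D_ξ(w₁d) D_ξ(w₂d) turns
-- the product into
--
--   w₁ w₂ t σ_{w₁}(P_{ξ^w₁}(d)) σ_{w₂}(P_{ξ^w₂}(d)) D_ξ(w₁w₂d)      (cleared),
--
-- which is visibly symmetric.  The factors D_ξ(wd) can be cancelled, because
-- their coefficient of t, namely ξ^(wd) wd, is invertible (⊛-cancelʳ).

open import Defs
open import Data.Integer.Base as ℤ using (1ℤ)
open import Data.Nat.Base as ℕ using (ℕ; NonZero; _∸_)
open import Data.Nat.Combinatorics using (_C_)
open import Data.Nat.Primality using (Prime)
open import Level using (Level)

import Algebra.Apartness.Properties.HeytingCommutativeRing as HeytingProperties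
import Algebra.Properties.CommutativeSemigroup as SemigroupProperties
import Algebra.Properties.CommutativeSemiring.Binomial as Binomial
import Algebra.Properties.CommutativeSemiring.Exp as ExpProperties
import Algebra.Properties.Ring as RingProperties
import Algebra.Properties.Semiring.Mult as MultProperties
import Algebra.Properties.Semiring.Sum as SumProperties
import Algebra.Solver.Ring.NaturalCoefficients.Default as SemiringSolver
import Data.Integer.Properties as ℤ
import Data.Nat.Properties as ℕ
import Relation.Binary.Reasoning.Setoid as SetoidReasoning
open import Algebra.Apartness.Bundles using (HeytingField)
open import Algebra.Bundles using (CommutativeRing; CommutativeSemiring)
open import Algebra.Structures.Biased using (isCommutativeSemiringˡ)
open import Data.Fin.Base using (toℕ)
open import Data.Fin.Properties using (toℕ≤pred[n])
open import Data.Nat.Base using (zero; suc; _!; _≤_)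
open import Data.Nat.Combinatorics using (nCk≡n!/k![n-k]!; k![n∸k]!∣n!)
open import Data.Nat.DivMod using (m/n*n≡m)
open import Data.Nat.Primality using (prime⇒nonZero)
open import Data.Product.Base using (_,_)
open import Relation.Binary.PropositionalEquality.Core as ≡ using (_≡_)
open import Relation.Binary.Structures using (IsEquivalence)

module Series {p c ℓ₁ ℓ₂} (ℂₚ : ComplexPadicField p c ℓ₁ ℓ₂) where

  open ComplexPadicField ℂₚ
  open TwistedBernoulli ℂₚ
  open DirichletCharacter
  open CommutativeRing commutativeRing using (commutativeSemiring; ring)
  open HeytingProperties (HeytingField.heytingCommutativeRing heytingField)
    using (x-0≈x; x#0y#0→xy#0; invertibleˡ⇒#; #-congʳ)
  open ExpProperties commutativeSemiring
    using (^-congˡ; ^-congʳ; ^-homo-*; ^-assocʳ; ^-distrib-*)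
  open MultProperties semiring using (×1-homo-*; ×-homo-+; ×-assoc-*; ×-congʳ)
  open SumProperties semiring using (sum-cong-≋; *-distribˡ-sum)
  open SemiringSolver commutativeSemiring using (solve; con; _:=_; _:+_; _:*_)

  module ≈-Reasoning = SetoidReasoning setoid

  -- Finite sums

  ∑≤-cong : ∀ n {f g} → (∀ i → i ≤ n → f i ≈ g i) → ∑≤ n f ≈ ∑≤ n g
  ∑≤-cong n f≈g = sum-cong-≋ {suc n} λ i → f≈g (toℕ i) (toℕ≤pred[n] i)

  ∑<-cong : ∀ n {f g} → (∀ i → f i ≈ g i) → ∑< n f ≈ ∑< n g
  ∑<-cong n f≈g = sum-cong-≋ {n} λ i → f≈g (toℕ i)

  *-distribˡ-∑≤ : ∀ n x f → x * ∑≤ n f ≈ ∑≤ n (λ i → x * f i)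
  *-distribˡ-∑≤ n x f = *-distribˡ-sum {suc n} x (λ i → f (toℕ i))

  *-distribˡ-∑< : ∀ n x f → x * ∑< n f ≈ ∑< n (λ i → x * f i)
  *-distribˡ-∑< n x f = *-distribˡ-sum {n} x (λ i → f (toℕ i))

  ∑<-split : ∀ a b f → ∑< (a ℕ.+ b) f ≈ ∑< a f + ∑< b (λ i → f (a ℕ.+ i))
  ∑<-split zero    b f = sym (+-identityˡ _)
  ∑<-split (suc a) b f = trans (+-congˡ (∑<-split a b λ i → f (suc i))) (sym (+-assoc _ _ _))

  -- The semiring of power series

  infixl 6 _⊕_
  infixl 7 _·_

  _⊕_ : PowerSeries → PowerSeries → PowerSeries
  (f ⊕ g) n = f n + g n

  0ₛ : PowerSeries
  0ₛ _ = 0#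

  -- Multiplication of a power series by a constant.
  _·_ : Carrier → PowerSeries → PowerSeries
  (x · f) n = x * f n

  ⊛-cong : ∀ {f f′ g g′} → f ≋ f′ → g ≋ g′ → f ⊛ g ≋ f′ ⊛ g′
  ⊛-cong f≋f′ g≋g′ n = ∑≤-cong n λ i _ → *-cong (f≋f′ i) (g≋g′ (n ∸ i))

  ⊛-zeroˡ : ∀ g → 0ₛ ⊛ g ≋ 0ₛ
  ⊛-zeroˡ g zero    = trans (+-identityʳ _) (zeroˡ _)
  ⊛-zeroˡ g (suc n) = trans (+-cong (zeroˡ _) (⊛-zeroˡ g n)) (+-identityʳ _)

  ⊛-identityˡ : ∀ g → 1ₛ ⊛ g ≋ g
  ⊛-identityˡ g zero    = trans (+-identityʳ _) (*-identityˡ _)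
  ⊛-identityˡ g (suc n) = trans (+-cong (*-identityˡ _) (⊛-zeroˡ g n)) (+-identityʳ _)

  ⊛-distribʳ : ∀ h f g → (f ⊕ g) ⊛ h ≋ f ⊛ h ⊕ g ⊛ h
  ⊛-distribʳ h f g zero    =
    solve 3 (λ a b c → (a :+ b) :* c :+ con 0 := (a :* c :+ con 0) :+ (b :* c :+ con 0)) refl _ _ _
  ⊛-distribʳ h f g (suc n) = trans (+-congˡ (⊛-distribʳ h (tail f) (tail g) n))
    (solve 5 (λ a b c d e → (a :+ b) :* c :+ (d :+ e) := (a :* c :+ d) :+ (b :* c :+ e))
      refl (f 0) (g 0) _ _ _)

  ·-⊛ : ∀ x f g → (x · f) ⊛ g ≋ x · (f ⊛ g)
  ·-⊛ x f g n = trans (∑≤-cong n λ i _ → *-assoc x (f i) (g (n ∸ i)))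
                      (sym (*-distribˡ-∑≤ n x λ i → f i * g (n ∸ i)))

  -- The definition of the product splits off the constant term of the left
  -- factor; this splits off that of the right factor.
  ⊛-unfoldʳ : ∀ f g n → (f ⊛ g) (suc n) ≈ f (suc n) * g 0 + (f ⊛ tail g) n
  ⊛-unfoldʳ f g zero    =
    solve 4 (λ a b c d → a :* b :+ (c :* d :+ con 0) := c :* d :+ (a :* b :+ con 0)) refl _ _ _ _
  ⊛-unfoldʳ f g (suc n) = trans (+-congˡ (⊛-unfoldʳ (tail f) g n))
    (solve 3 (λ a b c → a :+ (b :+ c) := b :+ (a :+ c)) refl _ _ _)

  ⊛-comm : ∀ f g → f ⊛ g ≋ g ⊛ f
  ⊛-comm f g zero    = +-congʳ (*-comm _ _)
  ⊛-comm f g (suc n) = trans (+-cong (*-comm _ _) (⊛-comm (tail f) g n)) (sym (⊛-unfoldʳ g f n))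

  ⊛-assoc : ∀ f g h → (f ⊛ g) ⊛ h ≋ f ⊛ (g ⊛ h)
  ⊛-assoc f g h zero    =
    solve 3 (λ a b c → (a :* b :+ con 0) :* c :+ con 0 := a :* (b :* c :+ con 0) :+ con 0) refl _ _ _
  ⊛-assoc f g h (suc n) = begin
    (f ⊛ g) 0 * h (suc n) + (tail (f ⊛ g) ⊛ h) n
      ≈⟨ +-congˡ (⊛-distribʳ h (f 0 · tail g) (tail f ⊛ g) n) ⟩
    (f ⊛ g) 0 * h (suc n) + (((f 0 · tail g) ⊛ h) n + ((tail f ⊛ g) ⊛ h) n)
      ≈⟨ +-congˡ (+-cong (·-⊛ (f 0) (tail g) h n) (⊛-assoc (tail f) g h n)) ⟩
    (f ⊛ g) 0 * h (suc n) + (f 0 * (tail g ⊛ h) n + (tail f ⊛ (g ⊛ h)) n)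
      ≈⟨ solve 5 (λ a b c d e → (a :* b :+ con 0) :* c :+ (a :* d :+ e) := a :* (b :* c :+ d) :+ e)
           refl _ _ _ _ _ ⟩
    f 0 * (g ⊛ h) (suc n) + (tail f ⊛ (g ⊛ h)) n ∎
    where
    open ≈-Reasoning

  ≋-isEquivalence : IsEquivalence _≋_
  ≋-isEquivalence = record
    { refl  = λ n → refl
    ; sym   = λ f≋g n → sym (f≋g n)
    ; trans = λ f≋g g≋h n → trans (f≋g n) (g≋h n)
    }

  -- Power series under Cauchy product, with coefficientwise equality.
  powerSeries : CommutativeSemiring c ℓ₁
  powerSeries = record
    { Carrier = PowerSeries
    ; _≈_     = _≋_
    ; _+_     = _⊕_
    ; _*_     = _⊛_
    ; 0#      = 0ₛ
    ; 1#      = 1ₛ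
    ; isCommutativeSemiring = isCommutativeSemiringˡ record
      { +-isCommutativeMonoid = record
        { isMonoid = record
          { isSemigroup = record
            { isMagma = record
              { isEquivalence = ≋-isEquivalence
              ; ∙-cong = λ f≋f′ g≋g′ n → +-cong (f≋f′ n) (g≋g′ n)
              }
            ; assoc = λ f g h n → +-assoc _ _ _
            }
          ; identity = (λ f n → +-identityˡ _) , (λ f n → +-identityʳ _)
          }
        ; comm = λ f g n → +-comm _ _
        }
      ; *-isCommutativeMonoid = record
        { isMonoid = record
          { isSemigroup = record
            { isMagma = record
              { isEquivalence = ≋-isEquivalence
              ; ∙-cong = ⊛-cong
              }
            ; assoc = ⊛-assoc
            }
          ; identity = ⊛-identityˡ , λ f n → trans (⊛-comm f 1ₛ n) (⊛-identityˡ f n)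
          }
        ; comm = ⊛-comm
        }
      ; distribʳ = ⊛-distribʳ
      ; zeroˡ    = ⊛-zeroˡ
      }
    }

  module ₛ = CommutativeSemiring powerSeries
  module ≋-Reasoning = SetoidReasoning ₛ.setoid
  open SemigroupProperties ₛ.*-commutativeSemigroup using (x∙yz≈y∙xz; interchange)

  ·-cong : ∀ x {f g} → f ≋ g → x · f ≋ x · g
  ·-cong x f≋g n = *-congˡ (f≋g n)

  ⊛-· : ∀ x f g → f ⊛ (x · g) ≋ x · (f ⊛ g)
  ⊛-· x f g n = trans (⊛-comm f (x · g) n) (trans (·-⊛ x g f n) (*-congˡ (⊛-comm g f n)))

  t·-cong : ∀ {f g} → f ≋ g → t· f ≋ t· g
  t·-cong f≋g zero    = refl
  t·-cong f≋g (suc n) = f≋g n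

  t·-⊛ : ∀ f g → t· f ⊛ g ≋ t· (f ⊛ g)
  t·-⊛ f g zero    = trans (+-identityʳ _) (zeroˡ _)
  t·-⊛ f g (suc n) = trans (+-congʳ (zeroˡ _)) (+-identityˡ _)

  ⊛-distribˡ-∑< : ∀ N f (g : ℕ → PowerSeries) →
                  f ⊛ (λ n → ∑[ l < N ] g l n) ≋ λ n → ∑[ l < N ] (f ⊛ g l) n
  ⊛-distribˡ-∑< zero    f g = ₛ.zeroʳ f
  ⊛-distribˡ-∑< (suc N) f g n =
    trans (ₛ.distribˡ f (g 0) (λ n → ∑[ l < N ] g (suc l) n) n)
          (+-congˡ (⊛-distribˡ-∑< N f (λ l → g (suc l)) n))

  -- The quotient q = t / h is a power series when h has an invertible
  -- coefficient of t, whatever its order, and multiplying k h by q gives t k.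
  ⊛-cancelʳ : ∀ f g h → h 1 # 0# → f ⊛ h ≋ g ⊛ h → f ≋ g
  ⊛-cancelʳ f g h h₁#0 fh≋gh n = t·f≋t·g (suc n)
    where
    open ≋-Reasoning

    q = t· 1ₛ ÷ h

    q⊛ : ∀ k → q ⊛ (k ⊛ h) ≋ t· k
    q⊛ k = begin
      q ⊛ (k ⊛ h)  ≈⟨ ₛ.*-congˡ {q} (⊛-comm k h) ⟩
      q ⊛ (h ⊛ k)  ≈⟨ ⊛-assoc q h k ⟨
      (q ⊛ h) ⊛ k  ≈⟨ ₛ.*-congʳ {k} (÷-correct (t· 1ₛ) h refl h₁#0) ⟩
      t· 1ₛ ⊛ k    ≈⟨ t·-⊛ 1ₛ k ⟩
      t· (1ₛ ⊛ k)  ≈⟨ t·-cong (⊛-identityˡ k) ⟩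
      t· k         ∎

    t·f≋t·g : t· f ≋ t· g
    t·f≋t·g = begin
      t· f         ≈⟨ q⊛ f ⟨
      q ⊛ (f ⊛ h)  ≈⟨ ₛ.*-congˡ {q} fh≋gh ⟩
      q ⊛ (g ⊛ h)  ≈⟨ q⊛ g ⟩
      t· g         ∎

  -- Inverses, integer powers and natural numbers in the field

  ⁻¹-cancelˡ : ∀ {x} → x # 0# → ∀ y → x ⁻¹ * (x * y) ≈ y
  ⁻¹-cancelˡ {x} x#0 y = begin
    x ⁻¹ * (x * y)  ≈⟨ *-assoc (x ⁻¹) x y ⟨
    x ⁻¹ * x * y    ≈⟨ *-congʳ (⁻¹-inverseˡ x#0) ⟩
    1# * y          ≈⟨ *-identityˡ y ⟩
    y               ∎
    where open ≈-Reasoning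

  *-cancelˡ-#0 : ∀ {x y z} → x # 0# → x * y ≈ x * z → y ≈ z
  *-cancelˡ-#0 {x} {y} {z} x#0 xy≈xz =
    trans (sym (⁻¹-cancelˡ x#0 y)) (trans (*-congˡ xy≈xz) (⁻¹-cancelˡ x#0 z))

  cross-multiply : ∀ {x y a b} → x # 0# → y # 0# → y * a ≈ x * b → x ⁻¹ * a ≈ y ⁻¹ * b
  cross-multiply {x} {y} {a} {b} x#0 y#0 ya≈xb = begin
    x ⁻¹ * a               ≈⟨ *-congˡ (⁻¹-cancelˡ y#0 a) ⟨
    x ⁻¹ * (y ⁻¹ * (y * a)) ≈⟨ *-congˡ (*-congˡ ya≈xb) ⟩
    x ⁻¹ * (y ⁻¹ * (x * b)) ≈⟨ solve 4 (λ i j x b → i :* (j :* (x :* b)) := j :* (i :* (x :* b)))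
                                 refl (x ⁻¹) (y ⁻¹) x b ⟩
    y ⁻¹ * (x ⁻¹ * (x * b)) ≈⟨ *-congˡ (⁻¹-cancelˡ x#0 b) ⟩
    y ⁻¹ * b               ∎
    where open ≈-Reasoning

  -- At j = n the exponent is -1.
  ^ℤ-pred : ∀ {x} → x # 0# → ∀ {n j} → j ≤ n →
            x ^ℤ (ℤ.+ n ℤ.- ℤ.+ j ℤ.- 1ℤ) ≈ x ⁻¹ * x ^ (n ∸ j)
  ^ℤ-pred {x} x#0 {n} {j} j≤n
    rewrite ℤ.m-n≡m⊖n n j | ℤ.⊖-≥ j≤n with n ∸ j
  ... | zero  = refl
  ... | suc k = sym (⁻¹-cancelˡ x#0 (x ^ k))

  ι-≡ : ∀ {m n} → m ≡ n → ι m ≈ ι n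
  ι-≡ ≡.refl = refl

  ι-* : ∀ m n → ι (m ℕ.* n) ≈ ι m * ι n
  ι-* = ×1-homo-*

  !#0 : ∀ n → ι (n !) # 0#
  !#0 n = ι#0 (n !) {{n ℕ.!≢0}}

  -- Exponential generating functions

  C*!*!≡! : ∀ {n k} → k ≤ n → (n C k) ℕ.* (k ! ℕ.* (n ∸ k) !) ≡ n !
  C*!*!≡! {n} {k} k≤n = ≡.trans (≡.cong (ℕ._* (k ! ℕ.* (n ∸ k) !)) (nCk≡n!/k![n-k]! k≤n))
    (m/n*n≡m {{k ℕ.!* n ∸ k !≢0}} (k![n∸k]!∣n! k≤n))

  -- If f and g are the exponential generating functions of (k! fₖ) and
  -- (k! gₖ), then f g is that of their binomial convolution.
  egf-⊛ : ∀ f g n → ι (n !) * (f ⊛ g) n ≈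
          (∑[ k ≤ n ] ι (n C k) * (ι (k !) * f k) * (ι ((n ∸ k) !) * g (n ∸ k)))
  egf-⊛ f g n = trans (*-distribˡ-∑≤ n (ι (n !)) λ k → f k * g (n ∸ k)) (∑≤-cong n term)
    where
    open ≈-Reasoning
    term : ∀ k → k ≤ n → ι (n !) * (f k * g (n ∸ k)) ≈
           ι (n C k) * (ι (k !) * f k) * (ι ((n ∸ k) !) * g (n ∸ k))
    term k k≤n = begin
      ι (n !) * (f k * g (n ∸ k))
        ≈⟨ *-congʳ (ι-≡ (C*!*!≡! k≤n)) ⟨
      ι ((n C k) ℕ.* (k ! ℕ.* (n ∸ k) !)) * (f k * g (n ∸ k))
        ≈⟨ *-congʳ (trans (ι-* (n C k) _) (*-congˡ (ι-* (k !) ((n ∸ k) !)))) ⟩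
      ι (n C k) * (ι (k !) * ι ((n ∸ k) !)) * (f k * g (n ∸ k))
        ≈⟨ solve 5 (λ c a b x y → c :* (a :* b) :* (x :* y) := c :* (a :* x) :* (b :* y))
             refl (ι (n C k)) (ι (k !)) (ι ((n ∸ k) !)) (f k) (g (n ∸ k)) ⟩
      ι (n C k) * (ι (k !) * f k) * (ι ((n ∸ k) !) * g (n ∸ k)) ∎

  egf-exp : ∀ x n → ι (n !) * exp x n ≈ x ^ n
  egf-exp x n = begin
    ι (n !) * (x ^ n * ι (n !) ⁻¹) ≈⟨ *-comm _ _ ⟩
    x ^ n * ι (n !) ⁻¹ * ι (n !)   ≈⟨ q₀*g₀≈f₀ (x ^ n) (!#0 n) ⟩
    x ^ n                          ∎
    where open ≈-Reasoning

  exp-cong : ∀ {x y} → x ≈ y → exp x ≋ exp y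
  exp-cong x≈y n = *-congʳ (^-congˡ n x≈y)

  exp-0 : exp 0# ≋ 1ₛ
  exp-0 n = *-cancelˡ-#0 (!#0 n) (trans (egf-exp 0# n) (sym (egf-1 n)))
    where
    egf-1 : ∀ n → ι (n !) * 1ₛ n ≈ 0# ^ n
    egf-1 zero    = trans (*-identityʳ _) (+-identityʳ 1#)
    egf-1 (suc n) = trans (zeroʳ _) (sym (zeroˡ _))

  exp-+ : ∀ x y → exp x ⊛ exp y ≋ exp (x + y)
  exp-+ x y n = *-cancelˡ-#0 (!#0 n) (begin
    ι (n !) * (exp x ⊛ exp y) n
      ≈⟨ egf-⊛ (exp x) (exp y) n ⟩
    (∑[ k ≤ n ] ι (n C k) * (ι (k !) * exp x k) * (ι ((n ∸ k) !) * exp y (n ∸ k)))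
      ≈⟨ ∑≤-cong n (λ k _ → term k) ⟩
    (∑[ k ≤ n ] (n C k) • (x ^ k * y ^ (n ∸ k)))
      ≈⟨ Binomial.theorem commutativeSemiring n x y ⟨
    (x + y) ^ n
      ≈⟨ egf-exp (x + y) n ⟨
    ι (n !) * exp (x + y) n ∎)
    where
    open ≈-Reasoning
    term : ∀ k → ι (n C k) * (ι (k !) * exp x k) * (ι ((n ∸ k) !) * exp y (n ∸ k)) ≈
           (n C k) • (x ^ k * y ^ (n ∸ k))
    term k = begin
      ι (n C k) * (ι (k !) * exp x k) * (ι ((n ∸ k) !) * exp y (n ∸ k))
        ≈⟨ *-cong (*-congˡ (egf-exp x k)) (egf-exp y (n ∸ k)) ⟩
      ι (n C k) * x ^ k * y ^ (n ∸ k)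
        ≈⟨ *-assoc _ _ _ ⟩
      ι (n C k) * (x ^ k * y ^ (n ∸ k))
        ≈⟨ ×-assoc-* (n C k) 1# _ ⟩
      (n C k) • (1# * (x ^ k * y ^ (n ∸ k)))
        ≈⟨ ×-congʳ (n C k) (*-identityˡ _) ⟩
      (n C k) • (x ^ k * y ^ (n ∸ k)) ∎

  -- Twisted exponentials

  -- E η l is the series η^l e^(lt).
  E : Carrier → ℕ → PowerSeries
  E η l = η ^ l · exp (ι l)

  E-zero : ∀ η → E η 0 ≋ 1ₛ
  E-zero η n = trans (*-identityˡ _) (exp-0 n)

  E-+ : ∀ η a b → E η a ⊛ E η b ≋ E η (a ℕ.+ b)
  E-+ η a b = begin
    E η a ⊛ E η b
      ≈⟨ ·-⊛ (η ^ a) (exp (ι a)) (E η b) ⟩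
    η ^ a · (exp (ι a) ⊛ E η b)
      ≈⟨ ·-cong (η ^ a) (⊛-· (η ^ b) (exp (ι a)) (exp (ι b))) ⟩
    η ^ a · (η ^ b · (exp (ι a) ⊛ exp (ι b)))
      ≈⟨ (λ n → *-congˡ (*-congˡ (exp-+ (ι a) (ι b) n))) ⟩
    η ^ a · (η ^ b · exp (ι a + ι b))
      ≈⟨ (λ n → sym (*-assoc _ _ _)) ⟩
    (η ^ a * η ^ b) · exp (ι a + ι b)
      ≈⟨ (λ n → *-cong (sym (^-homo-* η a b)) (exp-cong (sym (×-homo-+ 1# a b)) n)) ⟩
    E η (a ℕ.+ b) ∎
    where open ≋-Reasoning

  -- D η N is the series η^N e^(Nt) - 1; the denominator in the definition of
  -- the twisted Bernoulli numbers is D η d.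
  D : Carrier → ℕ → PowerSeries
  D η N n = E η N n - 1ₛ n

  D-⊕-1 : ∀ η N → D η N ⊕ 1ₛ ≋ E η N
  D-⊕-1 η N n = trans (+-assoc _ _ _) (trans (+-congˡ (-‿inverseˡ _)) (+-identityʳ _))

  D-zero : ∀ η → D η 0 ≋ 0ₛ
  D-zero η n = trans (+-congʳ (E-zero η n)) (-‿inverseʳ _)

  D-+ : ∀ η a b → D η (a ℕ.+ b) ≋ D η a ⊕ E η a ⊛ D η b
  D-+ η a b n = begin
    E η (a ℕ.+ b) n - 1ₛ n
      ≈⟨ +-congʳ (E-+ η a b n) ⟨
    (E η a ⊛ E η b) n - 1ₛ n
      ≈⟨ +-congʳ (ₛ.*-congˡ {E η a} (D-⊕-1 η b) n) ⟨
    (E η a ⊛ (D η b ⊕ 1ₛ)) n - 1ₛ n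
      ≈⟨ +-congʳ (ₛ.distribˡ (E η a) (D η b) 1ₛ n) ⟩
    (E η a ⊛ D η b) n + (E η a ⊛ 1ₛ) n - 1ₛ n
      ≈⟨ +-congʳ (+-congˡ (ₛ.*-identityʳ (E η a) n)) ⟩
    (E η a ⊛ D η b) n + E η a n - 1ₛ n
      ≈⟨ solve 3 (λ x y z → x :+ y :+ z := y :+ z :+ x) refl _ _ _ ⟩
    E η a n - 1ₛ n + (E η a ⊛ D η b) n ∎
    where open ≈-Reasoning

  -- Stated for the coefficient of t because the constant term η^N - 1 may
  -- vanish.
  D₁#0 : ∀ {η} → η # 0# → ∀ N .{{_ : NonZero N}} → D η N 1 # 0#
  D₁#0 η#0 N = #-congʳ (sym (x-0≈x _))
    (x#0y#0→xy#0 (^#0 η#0 N) (x#0y#0→xy#0 (^#0 (ι#0 N) 1) (⁻¹#0 (ι#0 1))))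

  -- Substitution of a multiple of the variable

  -- scale x f is f(xt).
  scale : Carrier → PowerSeries → PowerSeries
  scale x f n = x ^ n * f n

  scale-cong : ∀ x {f g} → f ≋ g → scale x f ≋ scale x g
  scale-cong x f≋g n = *-congˡ (f≋g n)

  scale-1 : ∀ x → scale x 1ₛ ≋ 1ₛ
  scale-1 x zero    = *-identityʳ _
  scale-1 x (suc n) = zeroʳ _

  scale-t· : ∀ x f → scale x (t· f) ≋ x · t· (scale x f)
  scale-t· x f zero    = trans (zeroʳ _) (sym (zeroʳ _))
  scale-t· x f (suc n) = *-assoc _ _ _

  scale-⊛ : ∀ x f g → scale x (f ⊛ g) ≋ scale x f ⊛ scale x g
  scale-⊛ x f g n = trans (*-distribˡ-∑≤ n (x ^ n) λ i → f i * g (n ∸ i)) (∑≤-cong n term)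
    where
    open ≈-Reasoning
    term : ∀ i → i ≤ n → x ^ n * (f i * g (n ∸ i)) ≈ scale x f i * scale x g (n ∸ i)
    term i i≤n = begin
      x ^ n * (f i * g (n ∸ i))
        ≈⟨ *-congʳ (^-congʳ x (≡.sym (ℕ.m+[n∸m]≡n i≤n))) ⟩
      x ^ (i ℕ.+ (n ∸ i)) * (f i * g (n ∸ i))
        ≈⟨ *-congʳ (^-homo-* x i (n ∸ i)) ⟩
      x ^ i * x ^ (n ∸ i) * (f i * g (n ∸ i))
        ≈⟨ solve 4 (λ a b c d → a :* b :* (c :* d) := a :* c :* (b :* d)) refl _ _ _ _ ⟩
      scale x f i * scale x g (n ∸ i) ∎

  scale-^ₛ : ∀ x f k → scale x (f ^ₛ k) ≋ scale x f ^ₛ k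
  scale-^ₛ x f zero    = scale-1 x
  scale-^ₛ x f (suc k) =
    ₛ.trans (scale-⊛ x f (f ^ₛ k)) (ₛ.*-congˡ {scale x f} (scale-^ₛ x f k))

  scale-E : ∀ ξ w l → scale (ι w) (E (ξ ^ w) l) ≋ E ξ (w ℕ.* l)
  scale-E ξ w l n = begin
    ι w ^ n * ((ξ ^ w) ^ l * (ι l ^ n * ι (n !) ⁻¹))
      ≈⟨ solve 4 (λ a b c d → a :* (b :* (c :* d)) := b :* (a :* c :* d)) refl _ _ _ _ ⟩
    (ξ ^ w) ^ l * (ι w ^ n * ι l ^ n * ι (n !) ⁻¹)
      ≈⟨ *-cong (^-assocʳ ξ w l) (*-congʳ (sym (^-distrib-* (ι w) (ι l) n))) ⟩
    ξ ^ (w ℕ.* l) * ((ι w * ι l) ^ n * ι (n !) ⁻¹)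
      ≈⟨ *-congˡ (exp-cong (sym (ι-* w l)) n) ⟩
    E ξ (w ℕ.* l) n ∎
    where open ≈-Reasoning

  scale-D : ∀ ξ w N → scale (ι w) (D (ξ ^ w) N) ≋ D ξ (w ℕ.* N)
  scale-D ξ w N n = begin
    ι w ^ n * (E (ξ ^ w) N n - 1ₛ n)
      ≈⟨ RingProperties.x[y-z]≈xy-xz ring _ _ _ ⟩
    scale (ι w) (E (ξ ^ w) N) n - scale (ι w) 1ₛ n
      ≈⟨ +-cong (scale-E ξ w N n) (-‿cong (scale-1 (ι w) n)) ⟩
    D ξ (w ℕ.* N) n ∎
    where open ≈-Reasoning

  -- Character sums

  module _ {d : ℕ} (ψ : DirichletCharacter d) where

    -- P η N is the series Σ_{l<N} χ(l) η^l e^(lt).  The numerator in the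
    -- definition of the twisted Bernoulli numbers is t P η d.
    P : Carrier → ℕ → PowerSeries
    P η N n = ∑[ l < N ] χ ψ (ℤ.+ l) * η ^ l * exp (ι l) n

    -- The power sum runs up to N - 1 inclusive.
    egf-P : ∀ η N .{{_ : NonZero N}} k → ι (k !) * P η N k ≈ powerSum ψ η k (N ∸ 1)
    egf-P η (suc N) k = trans (*-distribˡ-∑< (suc N) (ι (k !)) λ l → χ ψ (ℤ.+ l) * η ^ l * exp (ι l) k)
                              (∑<-cong (suc N) term)
      where
      open ≈-Reasoning
      term : ∀ l → ι (k !) * (χ ψ (ℤ.+ l) * η ^ l * exp (ι l) k) ≈
             χ ψ (ℤ.+ l) * η ^ l * ι l ^ k
      term l = begin
        ι (k !) * (χ ψ (ℤ.+ l) * η ^ l * exp (ι l) k)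
          ≈⟨ solve 3 (λ a b c → a :* (b :* c) := b :* (a :* c)) refl _ _ _ ⟩
        χ ψ (ℤ.+ l) * η ^ l * (ι (k !) * exp (ι l) k)
          ≈⟨ *-congˡ (egf-exp (ι l) k) ⟩
        χ ψ (ℤ.+ l) * η ^ l * ι l ^ k ∎

    -- Splits off the first period of the character.
    P-+ : ∀ η N → P η (d ℕ.+ N) ≋ P η d ⊕ E η d ⊛ P η N
    P-+ η N n = trans (∑<-split d N (λ l → term l n)) (+-congˡ (begin
      (∑[ l < N ] term (d ℕ.+ l) n)   ≈⟨ ∑<-cong N (λ l → shift l n) ⟨
      (∑[ l < N ] (E η d ⊛ term l) n) ≈⟨ ⊛-distribˡ-∑< N (E η d) term n ⟨
      (E η d ⊛ P η N) n               ∎))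
      where
      term : ℕ → PowerSeries
      term l = (χ ψ (ℤ.+ l) * η ^ l) · exp (ι l)

      χ-shift : ∀ l → χ ψ (ℤ.+ l) ≈ χ ψ (ℤ.+ (d ℕ.+ l))
      χ-shift l = trans (sym (periodic ψ (ℤ.+ l)))
        (reflexive (≡.cong (λ i → χ ψ (ℤ.+ i)) (ℕ.+-comm l d)))

      shift : ∀ l → E η d ⊛ term l ≋ term (d ℕ.+ l)
      shift l = begin
        E η d ⊛ term l
          ≈⟨ ₛ.*-congˡ {E η d} (λ n → *-assoc (χ ψ (ℤ.+ l)) (η ^ l) (exp (ι l) n)) ⟩
        E η d ⊛ (χ ψ (ℤ.+ l) · E η l)
          ≈⟨ ⊛-· (χ ψ (ℤ.+ l)) (E η d) (E η l) ⟩
        χ ψ (ℤ.+ l) · (E η d ⊛ E η l)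
          ≈⟨ (λ n → *-cong (χ-shift l) (E-+ η d l n)) ⟩
        χ ψ (ℤ.+ (d ℕ.+ l)) · E η (d ℕ.+ l)
          ≈⟨ (λ n → *-assoc _ _ _) ⟨
        term (d ℕ.+ l) ∎
        where open ≋-Reasoning

      open ≈-Reasoning

    -- P η (wd) is P η d times the sum of the powers of E η d with exponent
    -- below w, and D η (wd) is D η d times the same sum.
    geometric-sum : ∀ η w → P η (w ℕ.* d) ⊛ D η d ≋ P η d ⊛ D η (w ℕ.* d)
    geometric-sum η zero    = begin
      0ₛ ⊛ D η d    ≈⟨ ⊛-zeroˡ (D η d) ⟩
      0ₛ            ≈⟨ ₛ.zeroʳ (P η d) ⟨
      P η d ⊛ 0ₛ    ≈⟨ ₛ.*-congˡ {P η d} (D-zero η) ⟨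
      P η d ⊛ D η 0 ∎
      where open ≋-Reasoning
    geometric-sum η (suc w) = begin
      P η (d ℕ.+ w ℕ.* d) ⊛ D η d
        ≈⟨ ₛ.*-congʳ {D η d} (P-+ η (w ℕ.* d)) ⟩
      (P η d ⊕ E η d ⊛ P η (w ℕ.* d)) ⊛ D η d
        ≈⟨ ⊛-distribʳ (D η d) (P η d) (E η d ⊛ P η (w ℕ.* d)) ⟩
      P η d ⊛ D η d ⊕ E η d ⊛ P η (w ℕ.* d) ⊛ D η d
        ≈⟨ ₛ.+-congˡ {P η d ⊛ D η d} (begin
          E η d ⊛ P η (w ℕ.* d) ⊛ D η d   ≈⟨ ⊛-assoc (E η d) (P η (w ℕ.* d)) (D η d) ⟩
          E η d ⊛ (P η (w ℕ.* d) ⊛ D η d) ≈⟨ ₛ.*-congˡ {E η d} (geometric-sum η w) ⟩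
          E η d ⊛ (P η d ⊛ D η (w ℕ.* d)) ≈⟨ x∙yz≈y∙xz (E η d) (P η d) (D η (w ℕ.* d)) ⟩
          P η d ⊛ (E η d ⊛ D η (w ℕ.* d)) ∎) ⟩
      P η d ⊛ D η d ⊕ P η d ⊛ (E η d ⊛ D η (w ℕ.* d))
        ≈⟨ ₛ.distribˡ (P η d) (D η d) (E η d ⊛ D η (w ℕ.* d)) ⟨
      P η d ⊛ (D η d ⊕ E η d ⊛ D η (w ℕ.* d))
        ≈⟨ ₛ.*-congˡ {P η d} (D-+ η d (w ℕ.* d)) ⟨
      P η d ⊛ D η (d ℕ.+ w ℕ.* d) ∎
      where open ≋-Reasoning

    -- The exponential generating function of the twisted Bernoulli numbers of
    -- order 1.
    F : Carrier → PowerSeries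
    F η = numerator ψ η ÷ denominator ψ η

    egf-F : ∀ η k n → ι (n !) * (F η ^ₛ k) n ≈ bernoulli ψ η k n
    egf-F η k n = *-congˡ (sym (begin
      ((F η ^ₛ k) ⊛ exp 0#) n ≈⟨ ₛ.*-congˡ {F η ^ₛ k} exp-0 n ⟩
      ((F η ^ₛ k) ⊛ 1ₛ) n     ≈⟨ ₛ.*-identityʳ (F η ^ₛ k) n ⟩
      (F η ^ₛ k) n            ∎))
      where open ≈-Reasoning

    -- Symmetry of the generating functions

    module _ .{{_ : NonZero d}} {ξ : Carrier} (ξ#0 : ξ # 0#) where

      -- σF w is the series F_{ξ^w}(wt).
      σF : ℕ → PowerSeries
      σF w = scale (ι w) (F (ξ ^ w))

      -- σP w N is the series Σ_{l<N} χ(l) ξ^(wl) e^(wlt).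
      σP : ℕ → ℕ → PowerSeries
      σP w N = scale (ι w) (P (ξ ^ w) N)

      σF-D : ∀ w → σF w ⊛ D ξ (w ℕ.* d) ≋ ι w · t· (σP w d)
      σF-D w = begin
        σF w ⊛ D ξ (w ℕ.* d)
          ≈⟨ ₛ.*-congˡ {σF w} (scale-D ξ w d) ⟨
        σF w ⊛ scale (ι w) (D (ξ ^ w) d)
          ≈⟨ scale-⊛ (ι w) (F (ξ ^ w)) (D (ξ ^ w) d) ⟨
        scale (ι w) (F (ξ ^ w) ⊛ D (ξ ^ w) d)
          ≈⟨ scale-cong (ι w) (generating-identity ψ (^#0 ξ#0 w)) ⟩
        scale (ι w) (t· (P (ξ ^ w) d))
          ≈⟨ scale-t· (ι w) (P (ξ ^ w) d) ⟩
        ι w · t· (σP w d) ∎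
        where open ≋-Reasoning

      σP-D : ∀ w v → σP w (v ℕ.* d) ⊛ D ξ (w ℕ.* d) ≋ σP w d ⊛ D ξ (w ℕ.* (v ℕ.* d))
      σP-D w v = begin
        σP w (v ℕ.* d) ⊛ D ξ (w ℕ.* d)
          ≈⟨ ₛ.*-congˡ {σP w (v ℕ.* d)} (scale-D ξ w d) ⟨
        σP w (v ℕ.* d) ⊛ scale (ι w) (D (ξ ^ w) d)
          ≈⟨ scale-⊛ (ι w) (P (ξ ^ w) (v ℕ.* d)) (D (ξ ^ w) d) ⟨
        scale (ι w) (P (ξ ^ w) (v ℕ.* d) ⊛ D (ξ ^ w) d)
          ≈⟨ scale-cong (ι w) (geometric-sum (ξ ^ w) v) ⟩
        scale (ι w) (P (ξ ^ w) d ⊛ D (ξ ^ w) (v ℕ.* d))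
          ≈⟨ scale-⊛ (ι w) (P (ξ ^ w) d) (D (ξ ^ w) (v ℕ.* d)) ⟩
        σP w d ⊛ scale (ι w) (D (ξ ^ w) (v ℕ.* d))
          ≈⟨ ₛ.*-congˡ {σP w d} (scale-D ξ w (v ℕ.* d)) ⟩
        σP w d ⊛ D ξ (w ℕ.* (v ℕ.* d)) ∎
        where open ≋-Reasoning

      -- Up to commutativity, the right-hand side is invariant under the exchange
      -- of v and w.
      cleared : ∀ v w → (ι w · (σF v ⊛ σP w (v ℕ.* d))) ⊛ (D ξ (v ℕ.* d) ⊛ D ξ (w ℕ.* d)) ≋
                (ι w * ι v) · t· ((σP v d ⊛ σP w d) ⊛ D ξ (w ℕ.* (v ℕ.* d)))
      cleared v w = begin
        (ι w · (A ⊛ B)) ⊛ (Dᵥ ⊛ Dw)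
          ≈⟨ ·-⊛ (ι w) (A ⊛ B) (Dᵥ ⊛ Dw) ⟩
        ι w · ((A ⊛ B) ⊛ (Dᵥ ⊛ Dw))
          ≈⟨ ·-cong (ι w) (interchange A B Dᵥ Dw) ⟩
        ι w · ((A ⊛ Dᵥ) ⊛ (B ⊛ Dw))
          ≈⟨ ·-cong (ι w) (⊛-cong (σF-D v) (σP-D w v)) ⟩
        ι w · ((ι v · t· (σP v d)) ⊛ (σP w d ⊛ Dwv))
          ≈⟨ ·-cong (ι w) (·-⊛ (ι v) (t· (σP v d)) (σP w d ⊛ Dwv)) ⟩
        ι w · (ι v · (t· (σP v d) ⊛ (σP w d ⊛ Dwv)))
          ≈⟨ (λ n → *-assoc _ _ _) ⟨
        (ι w * ι v) · (t· (σP v d) ⊛ (σP w d ⊛ Dwv))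
          ≈⟨ ·-cong (ι w * ι v) (t·-⊛ (σP v d) (σP w d ⊛ Dwv)) ⟩
        (ι w * ι v) · t· (σP v d ⊛ (σP w d ⊛ Dwv))
          ≈⟨ ·-cong (ι w * ι v) (t·-cong (⊛-assoc (σP v d) (σP w d) Dwv)) ⟨
        (ι w * ι v) · t· ((σP v d ⊛ σP w d) ⊛ Dwv) ∎
        where
        open ≋-Reasoning
        A   = σF v
        B   = σP w (v ℕ.* d)
        Dᵥ  = D ξ (v ℕ.* d)
        Dw  = D ξ (w ℕ.* d)
        Dwv = D ξ (w ℕ.* (v ℕ.* d))

      σF-σP-symmetric : ∀ v w .{{_ : NonZero v}} .{{_ : NonZero w}} →
                        ι w · (σF v ⊛ σP w (v ℕ.* d)) ≋ ι v · (σF w ⊛ σP v (w ℕ.* d))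
      σF-σP-symmetric v w =
        ⊛-cancelʳ X Y Dᵥ (D₁#0 ξ#0 (v ℕ.* d) {{ℕ.m*n≢0 v d}})
          (⊛-cancelʳ (X ⊛ Dᵥ) (Y ⊛ Dᵥ) Dw (D₁#0 ξ#0 (w ℕ.* d) {{ℕ.m*n≢0 w d}}) (begin
            X ⊛ Dᵥ ⊛ Dw   ≈⟨ ⊛-assoc X Dᵥ Dw ⟩
            X ⊛ (Dᵥ ⊛ Dw) ≈⟨ cleared v w ⟩
            (ι w * ι v) · t· ((σP v d ⊛ σP w d) ⊛ D ξ (w ℕ.* (v ℕ.* d)))
              ≈⟨ (λ n → *-congʳ (*-comm (ι w) (ι v))) ⟩
            (ι v * ι w) · t· ((σP v d ⊛ σP w d) ⊛ D ξ (w ℕ.* (v ℕ.* d)))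
              ≈⟨ ·-cong (ι v * ι w) (t·-cong (⊛-cong (⊛-comm (σP v d) (σP w d)) D-swap)) ⟩
            (ι v * ι w) · t· ((σP w d ⊛ σP v d) ⊛ D ξ (v ℕ.* (w ℕ.* d)))
              ≈⟨ cleared w v ⟨
            Y ⊛ (Dw ⊛ Dᵥ) ≈⟨ ₛ.*-congˡ {Y} (⊛-comm Dw Dᵥ) ⟩
            Y ⊛ (Dᵥ ⊛ Dw) ≈⟨ ⊛-assoc Y Dᵥ Dw ⟨
            Y ⊛ Dᵥ ⊛ Dw   ∎))
        where
        open ≋-Reasoning
        X  = ι w · (σF v ⊛ σP w (v ℕ.* d))
        Y  = ι v · (σF w ⊛ σP v (w ℕ.* d))
        Dᵥ = D ξ (v ℕ.* d)
        Dw = D ξ (w ℕ.* d)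
        D-swap : D ξ (w ℕ.* (v ℕ.* d)) ≋ D ξ (v ℕ.* (w ℕ.* d))
        D-swap n = reflexive (≡.cong (λ N → D ξ N n)
          (SemigroupProperties.x∙yz≈y∙xz ℕ.*-commutativeSemigroup w v d))

      -- Convolution sums of Bernoulli numbers and power sums

      -- The inner sum of the identity, with Bernoulli numbers of order m.
      inner : ℕ → ℕ → ℕ → ℕ → Carrier
      inner v w m j = ∑[ k ≤ j ]
        ι (j C k) * powerSum ψ (ξ ^ w) k (v ℕ.* d ∸ 1) * bernoulli ψ (ξ ^ w) m (j ∸ k)

      -- One side of the identity, with Bernoulli numbers of order m + 1 in the
      -- outer and m in the inner sum: the left-hand side is that for v = w₁ and
      -- w = w₂, and the right-hand side that for v = w₂ and w = w₁.
      side : ℕ → ℕ → ℕ → ℕ → Carrier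
      side v w n m = ∑[ j ≤ n ]
        ι (n C j) * ι w ^ j * ι v ^ℤ (ℤ.+ n ℤ.- ℤ.+ j ℤ.- 1ℤ) * bernoulli ψ (ξ ^ v) (suc m) (n ∸ j)
        * inner v w m j

      egf-inner : ∀ v w .{{_ : NonZero v}} m j →
                  inner v w m j ≈ ι (j !) * (P (ξ ^ w) (v ℕ.* d) ⊛ F (ξ ^ w) ^ₛ m) j
      egf-inner v w m j = begin
        inner v w m j
          ≈⟨ ∑≤-cong j (λ k _ → *-cong
               (*-congˡ {ι (j C k)} (egf-P (ξ ^ w) (v ℕ.* d) {{ℕ.m*n≢0 v d}} k))
               (egf-F (ξ ^ w) m (j ∸ k))) ⟨
        (∑[ k ≤ j ] ι (j C k) * (ι (k !) * P (ξ ^ w) (v ℕ.* d) k)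
                    * (ι ((j ∸ k) !) * (F (ξ ^ w) ^ₛ m) (j ∸ k)))
          ≈⟨ egf-⊛ (P (ξ ^ w) (v ℕ.* d)) (F (ξ ^ w) ^ₛ m) j ⟨
        ι (j !) * (P (ξ ^ w) (v ℕ.* d) ⊛ F (ξ ^ w) ^ₛ m) j ∎
        where open ≈-Reasoning

      egf-side : ∀ v w .{{_ : NonZero v}} n m →
                 side v w n m ≈ ι v ⁻¹ * (ι (n !) *
                   ((σF v ⊛ σP w (v ℕ.* d)) ⊛ (σF v ^ₛ m ⊛ σF w ^ₛ m)) n)
      egf-side v w n m = begin
        side v w n m
          ≈⟨ ∑≤-cong n term ⟩
        (∑[ j ≤ n ] ι v ⁻¹ * (ι (n C j) * (ι (j !) * scale (ι w) H j)
                              * (ι ((n ∸ j) !) * scale (ι v) G (n ∸ j))))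
          ≈⟨ *-distribˡ-∑≤ n (ι v ⁻¹) (λ j → ι (n C j) * (ι (j !) * scale (ι w) H j)
               * (ι ((n ∸ j) !) * scale (ι v) G (n ∸ j))) ⟨
        ι v ⁻¹ * (∑[ j ≤ n ] ι (n C j) * (ι (j !) * scale (ι w) H j)
                              * (ι ((n ∸ j) !) * scale (ι v) G (n ∸ j)))
          ≈⟨ *-congˡ (egf-⊛ (scale (ι w) H) (scale (ι v) G) n) ⟨
        ι v ⁻¹ * (ι (n !) * (scale (ι w) H ⊛ scale (ι v) G) n)
          ≈⟨ *-congˡ (*-congˡ (regroup n)) ⟩
        ι v ⁻¹ * (ι (n !) * ((σF v ⊛ σP w (v ℕ.* d)) ⊛ (σF v ^ₛ m ⊛ σF w ^ₛ m)) n) ∎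
        where
        H G : PowerSeries
        H = P (ξ ^ w) (v ℕ.* d) ⊛ F (ξ ^ w) ^ₛ m
        G = F (ξ ^ v) ^ₛ suc m

        regroup : scale (ι w) H ⊛ scale (ι v) G ≋
                  (σF v ⊛ σP w (v ℕ.* d)) ⊛ (σF v ^ₛ m ⊛ σF w ^ₛ m)
        regroup = begin
          scale (ι w) H ⊛ scale (ι v) G
            ≈⟨ ⊛-comm (scale (ι w) H) (scale (ι v) G) ⟩
          scale (ι v) G ⊛ scale (ι w) H
            ≈⟨ ⊛-cong (scale-^ₛ (ι v) (F (ξ ^ v)) (suc m))
                 (scale-⊛ (ι w) (P (ξ ^ w) (v ℕ.* d)) (F (ξ ^ w) ^ₛ m)) ⟩
          (σF v ⊛ σF v ^ₛ m) ⊛ (σP w (v ℕ.* d) ⊛ scale (ι w) (F (ξ ^ w) ^ₛ m))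
            ≈⟨ interchange (σF v) (σF v ^ₛ m) (σP w (v ℕ.* d)) (scale (ι w) (F (ξ ^ w) ^ₛ m)) ⟩
          (σF v ⊛ σP w (v ℕ.* d)) ⊛ (σF v ^ₛ m ⊛ scale (ι w) (F (ξ ^ w) ^ₛ m))
            ≈⟨ ₛ.*-congˡ {σF v ⊛ σP w (v ℕ.* d)}
                 (ₛ.*-congˡ {σF v ^ₛ m} (scale-^ₛ (ι w) (F (ξ ^ w)) m)) ⟩
          (σF v ⊛ σP w (v ℕ.* d)) ⊛ (σF v ^ₛ m ⊛ σF w ^ₛ m) ∎
          where open ≋-Reasoning

        open ≈-Reasoning

        term : ∀ j → j ≤ n →
          ι (n C j) * ι w ^ j * ι v ^ℤ (ℤ.+ n ℤ.- ℤ.+ j ℤ.- 1ℤ) * bernoulli ψ (ξ ^ v) (suc m) (n ∸ j)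
          * inner v w m j ≈
          ι v ⁻¹ * (ι (n C j) * (ι (j !) * scale (ι w) H j)
                    * (ι ((n ∸ j) !) * scale (ι v) G (n ∸ j)))
        term j j≤n = begin
          ι (n C j) * ι w ^ j * ι v ^ℤ (ℤ.+ n ℤ.- ℤ.+ j ℤ.- 1ℤ) * bernoulli ψ (ξ ^ v) (suc m) (n ∸ j)
          * inner v w m j
            ≈⟨ *-cong (*-cong (*-congˡ (^ℤ-pred (ι#0 v) j≤n))
                              (sym (egf-F (ξ ^ v) (suc m) (n ∸ j))))
                      (egf-inner v w m j) ⟩
          ι (n C j) * ι w ^ j * (ι v ⁻¹ * ι v ^ (n ∸ j)) * (ι ((n ∸ j) !) * G (n ∸ j))
          * (ι (j !) * H j)
            ≈⟨ solve 8 (λ c x i y b g a h → c :* x :* (i :* y) :* (b :* g) :* (a :* h)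
                 := i :* (c :* (a :* (x :* h)) :* (b :* (y :* g))))
                 refl (ι (n C j)) (ι w ^ j) (ι v ⁻¹) (ι v ^ (n ∸ j))
                 (ι ((n ∸ j) !)) (G (n ∸ j)) (ι (j !)) (H j) ⟩
          ι v ⁻¹ * (ι (n C j) * (ι (j !) * scale (ι w) H j)
                    * (ι ((n ∸ j) !) * scale (ι v) G (n ∸ j))) ∎

      side-symmetric : ∀ v w .{{_ : NonZero v}} .{{_ : NonZero w}} n m →
                       side v w n m ≈ side w v n m
      side-symmetric v w n m = begin
        side v w n m
          ≈⟨ egf-side v w n m ⟩
        ι v ⁻¹ * (ι (n !) * (X ⊛ (σF v ^ₛ m ⊛ σF w ^ₛ m)) n)
          ≈⟨ cross-multiply (ι#0 v) (ι#0 w) (begin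
            ι w * (ι (n !) * (X ⊛ (σF v ^ₛ m ⊛ σF w ^ₛ m)) n)
              ≈⟨ move (ι w) X (σF v ^ₛ m ⊛ σF w ^ₛ m) ⟩
            ι (n !) * ((ι w · X) ⊛ (σF v ^ₛ m ⊛ σF w ^ₛ m)) n
              ≈⟨ *-congˡ (⊛-cong (σF-σP-symmetric v w) (⊛-comm (σF v ^ₛ m) (σF w ^ₛ m)) n) ⟩
            ι (n !) * ((ι v · Y) ⊛ (σF w ^ₛ m ⊛ σF v ^ₛ m)) n
              ≈⟨ move (ι v) Y (σF w ^ₛ m ⊛ σF v ^ₛ m) ⟨
            ι v * (ι (n !) * (Y ⊛ (σF w ^ₛ m ⊛ σF v ^ₛ m)) n) ∎) ⟩
        ι w ⁻¹ * (ι (n !) * (Y ⊛ (σF w ^ₛ m ⊛ σF v ^ₛ m)) n)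
          ≈⟨ egf-side w v n m ⟨
        side w v n m ∎
        where
        open ≈-Reasoning
        X Y : PowerSeries
        X = σF v ⊛ σP w (v ℕ.* d)
        Y = σF w ⊛ σP v (w ℕ.* d)
        move : ∀ x f g → x * (ι (n !) * (f ⊛ g) n) ≈ ι (n !) * ((x · f) ⊛ g) n
        move x f g = trans
          (solve 3 (λ x a b → x :* (a :* b) := a :* (x :* b)) refl x (ι (n !)) ((f ⊛ g) n))
          (*-congˡ (sym (·-⊛ x f g n)))

  -- Roots of unity

  ^≈1⇒#0 : ∀ {x} n .{{_ : NonZero n}} → x ^ n ≈ 1# → x # 0#
  ^≈1⇒#0 {x} (suc n) xⁿ⁺¹≈1 = invertibleˡ⇒# (x ^ n , (begin
    x ^ n * (x - 0#) ≈⟨ *-congˡ (x-0≈x x) ⟩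
    x ^ n * x        ≈⟨ *-comm _ _ ⟩
    x ^ suc n        ≈⟨ xⁿ⁺¹≈1 ⟩
    1#               ∎))
    where open ≈-Reasoning

  -- The primality of p only serves to make the exponent p^n nonzero.
  T#0 : Prime p → ∀ {ξ} → ξ ∈T → ξ # 0#
  T#0 p-prime (n , _ , ξ^≈1) = ^≈1⇒#0 (p ℕ.^ n) {{ℕ.m^n≢0 p n {{prime⇒nonZero p-prime}}}} ξ^≈1

corollary2 : {c ℓ₁ ℓ₂ : Level} (p : ℕ) → Prime p → (ℂₚ : ComplexPadicField p c ℓ₁ ℓ₂) →
    let open ComplexPadicField ℂₚ
        open TwistedBernoulli ℂₚ
    in
    (d w₁ w₂ : ℕ) .{{_ : NonZero d}} .{{_ : NonZero w₁}} .{{_ : NonZero w₂}} →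
    (χ : DirichletCharacter d) → HasConductor χ d →
    (ξ : Carrier) → ξ ∈T →
    (n m : ℕ) .{{_ : NonZero m}} →
    (∑[ j ≤ n ]
       ι (n C j) * ι w₂ ^ j * ι w₁ ^ℤ (ℤ.+ n ℤ.- ℤ.+ j ℤ.- 1ℤ) * bernoulli χ (ξ ^ w₁) m (n ∸ j)
       * (∑[ k ≤ j ]
            ι (j C k) * powerSum χ (ξ ^ w₂) k (w₁ ℕ.* d ∸ 1) * bernoulli χ (ξ ^ w₂) (m ∸ 1) (j ∸ k)))
    ≈
    (∑[ j ≤ n ]
       ι (n C j) * ι w₁ ^ j * ι w₂ ^ℤ (ℤ.+ n ℤ.- ℤ.+ j ℤ.- 1ℤ) * bernoulli χ (ξ ^ w₂) m (n ∸ j)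
       * (∑[ k ≤ j ]
            ι (j C k) * powerSum χ (ξ ^ w₁) k (w₂ ℕ.* d ∸ 1) * bernoulli χ (ξ ^ w₁) (m ∸ 1) (j ∸ k)))
corollary2 p p-prime ℂₚ d w₁ w₂ χ _ ξ ξ∈T n (suc m) =
  side-symmetric χ (T#0 p-prime ξ∈T) w₁ w₂ n m
  where open Series ℂₚ
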